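{- For every integer capacity $B\ge 1$ there exists an instance of the Asymmetric Trading Prophets (ATP) problem with capacity $B$ and initial inventory $B_0=0$ such that the optimal offline algorithm achieves an expected profit strictly greater than $0$, while no online algorithm achieves an expected profit greater than $0$.
   Context: ATP problem. A decision maker interacts with $T$ sequentially arriving requests to trade copies of a product. She has capacity $B\ge 1$ (she may hold at most $B$ copies at any time) and starts with an initial inventory of $B_0\in\{0,\dots,B\}$ copies. It is assumed throughout that $T\ge B_0$ and $B\le B_0+T$. At time $t\in\{1,\dots,T\}$ a price tuple $(b_t,s_t)$ is revealed, with $b_t\in[0,+\infty]$ (the cost of buying a copy; $b_t=+\infty$ means buying is impossible) and $s_t\in[0,\infty)$ (the revenue from selling a copy); $(b_t,s_t)$ is drawn from a known distribution $\mathcal D_t$, independently across $t$, while $b_t$ and $s_t$ may be arbitrarily correlated with each other. At time $t$ she takes exactly one action: Buy one copy at price $b_t$ (allowed if she holds at most $B-1$ copies), Sell one copy at price $s_t$ (allowed if she holds at least one copy), or Skip. Profit is total revenue from sales minus total cost of purchases. An online algorithm (possibly randomized) chooses its action at time $t$ knowing only the distributions, the tuples revealed up to and including time $t$, and its past actions. The optimal offline algorithm knows all realized tuples in advance and attains the maximum possible profit for each realization; its expected profit is the expectation of this maximum. -}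

module Defs where

open import Algebra.Apartness.Structures using (IsHeytingField)
open import Algebra.Bundles using (CommutativeRing)
open import Algebra.Core using (Op₁; Op₂)
import Algebra.Properties.Semiring.Sum as SemiringSum
open import Data.Fin.Base using (Fin)
open import Data.List.Base as List using (List; []; _∷_; foldr; filter; cartesianProductWith)
open import Data.Nat.Base as ℕ using (ℕ; zero; suc)
import Data.Nat.Properties as ℕ
open import Data.Product.Base using (∃; _×_; _,_)
open import Data.Sum.Base using (_⊎_)
open import Data.Unit.Base using (⊤; tt)
open import Data.Empty using (⊥)
open import Data.Vec.Base using (Vec; []; _∷_)
open import Level using (Level) renaming (_⊔_ to _⊔ℓ_; suc to lsuc)
open import Relation.Binary.Core using (Rel)
open import Relation.Binary.Construct.Add.Supremum.NonStrict as AddSupremum using ()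
open import Relation.Binary.Definitions using (Cotransitive)
open import Relation.Binary.Lattice.Definitions using (Supremum)
open import Relation.Binary.Structures using (IsStrictPartialOrder)
open import Relation.Nullary.Construct.Add.Supremum using (_⁺; [_]; ⊤⁺)
open import Relation.Nullary.Decidable.Core using (Dec; yes; no; _×-dec_)
open import Relation.Nullary.Negation.Core using (¬_)

private
  variable
    a : Level
    A : Set a

-- The library has no real numbers, so prices and probabilities are taken in an
-- arbitrary ordered field. The axioms are the usual constructive ones: they
-- hold for the Cauchy and the Dedekind reals, whose order is not decidable, as
-- well as for ℚ; for a decidable order they are the classical ones.
-- Apartness is x < y ⊎ y < x, and x ≤ y means ¬ (y < x).
record OrderedField c ℓ₁ ℓ₂ : Set (lsuc (c ⊔ℓ ℓ₁ ⊔ℓ ℓ₂)) where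
  infix  8 -_
  infixl 7 _*_
  infixl 6 _+_
  infixr 6 _⊔_
  infix  4 _≈_ _<_ _≤_
  field
    Carrier : Set c
    _≈_     : Rel Carrier ℓ₁
    _<_     : Rel Carrier ℓ₂
    _+_     : Op₂ Carrier
    _*_     : Op₂ Carrier
    -_      : Op₁ Carrier
    _⊔_     : Op₂ Carrier
    0#      : Carrier
    1#      : Carrier

  _≤_ : Rel Carrier ℓ₂
  x ≤ y = ¬ (y < x)

  field
    isHeytingField         : IsHeytingField _≈_ (λ x y → x < y ⊎ y < x) _+_ _*_ -_ 0# 1#
    <-isStrictPartialOrder : IsStrictPartialOrder _≈_ _<_
    <-cotrans              : Cotransitive _<_
    +-monoˡ-<              : ∀ {x y} z → x < y → x + z < y + z
    *-pos                  : ∀ {x y} → 0# < x → 0# < y → 0# < x * y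
    ⊔-supremum             : Supremum _≤_ _⊔_

  open IsHeytingField isHeytingField public

  commutativeRing : CommutativeRing c ℓ₁
  commutativeRing = record { isCommutativeRing = isCommutativeRing }

  open CommutativeRing commutativeRing public using (semiring)

data Action : Set where
  buy sell skip : Action

move : Action → ℕ → ℕ
move buy  n = suc n
move sell n = ℕ.pred n
move skip n = n

-- Every action sequence of length T, feasible or not.
sequences : ∀ T → List (Vec Action T)
sequences zero    = [] ∷ []
sequences (suc T) = cartesianProductWith _∷_ (buy ∷ sell ∷ skip ∷ []) (sequences T)

module ATP {c ℓ₁ ℓ₂} (R : OrderedField c ℓ₁ ℓ₂) where
  open OrderedField R
  open SemiringSum semiring using (sum)
  open AddSupremum _≤_ using (_≤⁺_)

  -- A probability distribution with finite support; outcomes may repeat.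
  record Dist (A : Set a) : Set (a ⊔ℓ c ⊔ℓ ℓ₁ ⊔ℓ ℓ₂) where
    field
      size     : ℕ
      weight   : Fin size → Carrier
      outcome  : Fin size → A
      weight≥0 : ∀ i → 0# ≤ weight i
      total    : sum weight ≈ 1#

  𝔼 : Dist A → (A → Carrier) → Carrier
  𝔼 d f = sum (λ i → weight i * f (outcome i))
    where open Dist d

  -- Expectation when the coordinates are independent, the t-th having the t-th
  -- distribution of the vector: an iterated sum over the product of supports.
  𝔼-indep : ∀ {T} → Vec (Dist A) T → (Vec A T → Carrier) → Carrier
  𝔼-indep []       f = f []
  𝔼-indep (d ∷ ds) f = 𝔼 d (λ x → 𝔼-indep ds (λ xs → f (x ∷ xs)))

  -- The pair (b , s), with b in [0, +∞] and s in [0, ∞); ⊤⁺ is +∞.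
  record PriceTuple : Set (c ⊔ℓ ℓ₂) where
    constructor prices
    field
      b    : Carrier ⁺
      s    : Carrier
      .b≥0 : [ 0# ] ≤⁺ b
      .s≥0 : 0# ≤ s
  open PriceTuple public

  Finite : Carrier ⁺ → Set
  Finite [ _ ] = ⊤
  Finite ⊤⁺    = ⊥

  finite? : ∀ x → Dec (Finite x)
  finite? [ _ ] = yes tt
  finite? ⊤⁺    = no λ ()

  -- Allowed B n p x: with capacity B and n copies in hand, action x may be
  -- taken at prices p.
  Allowed : ℕ → ℕ → PriceTuple → Action → Set
  Allowed B n p buy  = n ℕ.< B × Finite (b p)
  Allowed B n p sell = 0 ℕ.< n
  Allowed B n p skip = ⊤

  allowed? : ∀ B n p x → Dec (Allowed B n p x)
  allowed? B n p buy  = (n ℕ.<? B) ×-dec finite? (b p)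
  allowed? B n p sell = 0 ℕ.<? n
  allowed? B n p skip = yes tt

  Feasible : ∀ {T} → ℕ → ℕ → Vec PriceTuple T → Vec Action T → Set
  Feasible B n []       []       = ⊤
  Feasible B n (p ∷ ps) (x ∷ xs) = Allowed B n p x × Feasible B (move x n) ps xs

  feasible? : ∀ {T} B n (ps : Vec PriceTuple T) xs → Dec (Feasible B n ps xs)
  feasible? B n []       []       = yes tt
  feasible? B n (p ∷ ps) (x ∷ xs) = allowed? B n p x ×-dec feasible? B (move x n) ps xs

  -- The value for buying at +∞ is irrelevant, as that is never allowed.
  gain : PriceTuple → Action → Carrier
  gain p sell = s p
  gain p skip = 0#
  gain p buy with b p
  ... | [ x ] = - x
  ... | ⊤⁺    = 0#

  profit : ∀ {T} → Vec PriceTuple T → Vec Action T → Carrier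
  profit []       []       = 0#
  profit (p ∷ ps) (x ∷ xs) = gain p x + profit ps xs

  record Instance (B B₀ : ℕ) : Set (c ⊔ℓ ℓ₁ ⊔ℓ ℓ₂) where
    field
      T      : ℕ
      𝒟      : Vec (Dist PriceTuple) T
      1≤B    : 1 ℕ.≤ B
      B₀≤B   : B₀ ℕ.≤ B
      B₀≤T   : B₀ ℕ.≤ T
      B≤B₀+T : B ℕ.≤ B₀ ℕ.+ T

  -- Maximum over all feasible action sequences. The base value 0# is the profit
  -- of skipping throughout, which is feasible.
  maxProfit : ∀ {T} → ℕ → ℕ → Vec PriceTuple T → Carrier
  maxProfit {T} B B₀ ps =
    foldr _⊔_ 0# (List.map (profit ps) (filter (feasible? B B₀ ps) (sequences T)))

  -- Past price tuples and actions, most recent first.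
  History : Set (c ⊔ℓ ℓ₂)
  History = List (PriceTuple × Action)

  held : ℕ → History → ℕ
  held B₀ []            = B₀
  held B₀ ((_ , x) ∷ h) = move x (held B₀ h)

  -- A randomized online algorithm: given the history and the current prices, a
  -- distribution over the actions allowed there. The time is the length of the
  -- history.
  OnlineAlgorithm : ∀ {B B₀} → Instance B B₀ → Set (c ⊔ℓ ℓ₁ ⊔ℓ ℓ₂)
  OnlineAlgorithm {B} {B₀} _ =
    (h : History) (p : PriceTuple) → Dist (∃ (Allowed B (held B₀ h) p))

  module _ {B B₀ : ℕ} (I : Instance B B₀) where
    open Instance I

    offlineProfit : Carrier
    offlineProfit = 𝔼-indep 𝒟 (maxProfit B B₀)

    -- Expected profit on given prices, over the algorithm's own randomness,
    -- from history h onwards.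
    runOn : ∀ {k} → OnlineAlgorithm I → History → Vec PriceTuple k → Carrier
    runOn alg h []       = 0#
    runOn alg h (p ∷ ps) =
      𝔼 (alg h p) (λ (x , _) → gain p x + runOn alg ((p , x) ∷ h) ps)

    onlineProfit : OnlineAlgorithm I → Carrier
    onlineProfit alg = 𝔼-indep 𝒟 (runOn alg [])

{-# OPTIONS --safe #-}
-- A copy can be bought at time 1 for ½; at time 2 copies sell at 0 or at 1, each
-- with probability ½, and cannot be bought. All later prices are dull: nothing
-- can be bought, and copies sell at 0. Buying before the coin is tossed is a
-- fair bet, so no online algorithm gains, while the offline optimum buys exactly
-- when the price rises and so earns ½ with probability ½.
module Submission where

open import Defs
open import Data.Empty using (⊥-elim)
open import Data.Fin.Base using (Fin; zero; suc)
open import Data.List.Base using ([]; _∷_; foldr)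
open import Data.List.Membership.Propositional using (_∈_)
open import Data.List.Membership.Propositional.Properties
  using (∈-cartesianProductWith⁺; ∈-filter⁺; ∈-map⁺)
open import Data.List.Relation.Unary.Any using (here; there)
open import Data.Nat.Base as ℕ using (ℕ; zero; suc; z≤n; s≤s) renaming (_≤_ to _≤ℕ_)
import Data.Nat.Properties as ℕ
open import Data.Product.Base using (Σ-syntax; ∃-syntax; ∃; _×_; _,_; proj₁; proj₂)
open import Data.Sum.Base using (inj₁; inj₂)
open import Data.Unit.Base using (tt)
open import Data.Vec.Base using (Vec; []; _∷_; replicate)
open import Relation.Binary.PropositionalEquality.Core as ≡ using (_≡_)
open import Relation.Binary.Structures using (IsStrictPartialOrder)
open import Relation.Nullary.Construct.Add.Supremum using ([_]; ⊤⁺)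
open import Relation.Binary.Construct.Add.Supremum.NonStrict using ([_]; _≤⊤⁺)
open import Relation.Nullary.Negation.Core using (¬_)
import Algebra.Apartness.Bundles as Apartness
import Algebra.Apartness.Properties.HeytingCommutativeRing as HeytingProperties
open import Algebra.Bundles using (CommutativeRing)
import Algebra.Properties.Ring as RingProperties
import Algebra.Properties.Semiring.Sum as SemiringSum
import Relation.Binary.Reasoning.Setoid as ≈-Reasoning

-- Completeness of the enumeration: only the feasibility filter can keep an action sequence out of
-- the maximum defining `maxProfit`.
∈-sequences : ∀ {T} (xs : Vec Action T) → xs ∈ sequences T
∈-sequences []       = here ≡.refl
∈-sequences (x ∷ xs) = ∈-cartesianProductWith⁺ _∷_ (∈-actions x) (∈-sequences xs)
  where
  ∈-actions : ∀ x → x ∈ buy ∷ sell ∷ skip ∷ []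
  ∈-actions buy  = here ≡.refl
  ∈-actions sell = there (here ≡.refl)
  ∈-actions skip = there (there (here ≡.refl))

-- Order and arithmetic in a constructive ordered field.

module OrderedFieldProperties {c ℓ₁ ℓ₂} (R : OrderedField c ℓ₁ ℓ₂) where
  open OrderedField R hiding (zero)
  open CommutativeRing commutativeRing using (ring)
  open RingProperties ring using (-‿distribˡ-*; -‿involutive; x[y-z]≈xy-xz)
  open SemiringSum semiring using (sum)
  open IsStrictPartialOrder <-isStrictPartialOrder public
    using () renaming
      ( irrefl to <-irrefl; asym to <-asym
      ; <-respʳ-≈ to <-respʳ; <-respˡ-≈ to <-respˡ )
  open ≈-Reasoning setoid

  heytingCommutativeRing : Apartness.HeytingCommutativeRing c ℓ₁ ℓ₂
  heytingCommutativeRing = record { isHeytingCommutativeRing = isHeytingCommutativeRing }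

  open HeytingProperties heytingCommutativeRing using (1#0; x-0≈x)

  ≤-refl : ∀ {x} → x ≤ x
  ≤-refl = <-irrefl refl

  <⇒≤ : ∀ {x y} → x < y → x ≤ y
  <⇒≤ x<y y<x = <-asym x<y y<x

  -- Since `_≤_` is a negated strict order, transitivity comes from cotransitivity: `z < x` would
  -- put `y` above `z` or below `x`.
  ≤-trans : ∀ {x y z} → x ≤ y → y ≤ z → x ≤ z
  ≤-trans {y = y} x≤y y≤z z<x with <-cotrans z<x y
  ... | inj₁ z<y = y≤z z<y
  ... | inj₂ y<x = x≤y y<x

  <-≤-trans : ∀ {x y z} → x < y → y ≤ z → x < z
  <-≤-trans {z = z} x<y y≤z with <-cotrans x<y z
  ... | inj₁ x<z = x<z
  ... | inj₂ z<y = ⊥-elim (y≤z z<y)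

  ≤-reflexive : ∀ {x y} → x ≈ y → x ≤ y
  ≤-reflexive x≈y = <-irrefl (sym x≈y)

  ≤-antisym : ∀ {x y} → x ≤ y → y ≤ x → x ≈ y
  ≤-antisym {x} {y} x≤y y≤x = proj₁ (tight x y) λ where
    (inj₁ x<y) → y≤x x<y
    (inj₂ y<x) → x≤y y<x

  +-cancelʳ-< : ∀ {x y} z → x + z < y + z → x < y
  +-cancelʳ-< z lt = <-respˡ (cancel _) (<-respʳ (cancel _) (+-monoˡ-< (- z) lt))
    where
    cancel : ∀ x → x + z + - z ≈ x
    cancel x = trans (+-assoc x z (- z)) (trans (+-congˡ (-‿inverseʳ z)) (+-identityʳ x))

  +-monoˡ-≤ : ∀ {x y} z → x ≤ y → x + z ≤ y + z
  +-monoˡ-≤ z x≤y lt = x≤y (+-cancelʳ-< z lt)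

  +-mono-≤ : ∀ {x y u v} → x ≤ y → u ≤ v → x + u ≤ y + v
  +-mono-≤ {x} {y} {u} {v} x≤y u≤v =
    ≤-trans (+-monoˡ-≤ u x≤y)
      (≤-trans (≤-reflexive (+-comm y u))
        (≤-trans (+-monoˡ-≤ y u≤v) (≤-reflexive (+-comm v y))))

  +-nonPositive : ∀ {x y} → x ≤ 0# → y ≤ 0# → x + y ≤ 0#
  +-nonPositive x≤0 y≤0 = ≤-trans (+-mono-≤ x≤0 y≤0) (≤-reflexive (+-identityˡ 0#))

  +-nonNegative-positive : ∀ {x y} → 0# ≤ x → 0# < y → 0# < x + y
  +-nonNegative-positive {x} {y} 0≤x 0<y =
    <-≤-trans 0<y (≤-trans (≤-reflexive (sym (+-identityˡ y))) (+-monoˡ-≤ y 0≤x))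

  -- The conclusion is a negation, so the factors may be assumed to be either
  -- positive or zero.
  *-nonNegative : ∀ {x y} → 0# ≤ x → 0# ≤ y → 0# ≤ x * y
  *-nonNegative {x} {y} 0≤x 0≤y xy<0 =
    ¬¬pos 0≤x (λ x≈0 → trans (*-congʳ x≈0) (zeroˡ y)) λ 0<x →
    ¬¬pos 0≤y (λ y≈0 → trans (*-congˡ y≈0) (zeroʳ x)) λ 0<y →
    <-asym xy<0 (*-pos 0<x 0<y)
    where
    ¬¬pos : ∀ {z} → 0# ≤ z → (z ≈ 0# → x * y ≈ 0#) → ¬ ¬ (0# < z)
    ¬¬pos 0≤z vanish z≯0 = <-irrefl (vanish (≤-antisym z≯0 0≤z)) xy<0

  -- A strict reversal would make `w * (y + - x)` negative, although both factors are nonnegative.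
  *-monoˡ-≤ : ∀ {w x y} → 0# ≤ w → x ≤ y → w * x ≤ w * y
  *-monoˡ-≤ {w} {x} {y} 0≤w x≤y wy<wx =
    *-nonNegative 0≤w 0≤y-x
      (<-respˡ (sym (x[y-z]≈xy-xz w y x))
        (<-respʳ (-‿inverseʳ (w * x)) (+-monoˡ-< (- (w * x)) wy<wx)))
    where
    0≤y-x : 0# ≤ y + - x
    0≤y-x = ≤-trans (≤-reflexive (sym (-‿inverseʳ x))) (+-monoˡ-≤ (- x) x≤y)

  0<1 : 0# < 1#
  0<1 with 1#0
  ... | inj₂ 0<1 = 0<1
  -- If `1# < 0#`, then `- 1#` is positive, and so is its square, which is `1#`.
  ... | inj₁ 1<0 = <-respʳ -1*-1≈1 (*-pos 0<-1 0<-1)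
    where
    0<-1 : 0# < - 1#
    0<-1 = <-respˡ (-‿inverseʳ 1#) (<-respʳ (+-identityˡ (- 1#)) (+-monoˡ-< (- 1#) 1<0))

    -1*-1≈1 : - 1# * - 1# ≈ 1#
    -1*-1≈1 = begin
      - 1# * - 1#    ≈⟨ -‿distribˡ-* 1# (- 1#) ⟨
      - (1# * - 1#)  ≈⟨ -‿cong (*-identityˡ (- 1#)) ⟩
      - - 1#         ≈⟨ -‿involutive 1# ⟩
      1#             ∎

  -- The sum `1# + 1#` is positive, hence apart from `0#`, hence invertible. Apartness yields an
  -- inverse of the difference `1# + 1# + - 0#`, so the zero has to be removed.
  halves : ∃[ h ] h + h ≈ 1#
  halves with #⇒invertible (inj₂ (+-nonNegative-positive (<⇒≤ 0<1) 0<1))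
  ... | h , h*2≈1 , _ = h , (begin
    h + h                  ≈⟨ +-cong (*-identityʳ h) (*-identityʳ h) ⟨
    h * 1# + h * 1#        ≈⟨ distribˡ h 1# 1# ⟨
    h * (1# + 1#)          ≈⟨ *-congˡ (x-0≈x (1# + 1#)) ⟨
    h * (1# + 1# + - 0#)   ≈⟨ h*2≈1 ⟩
    1#                     ∎)

  ½ : Carrier
  ½ = proj₁ halves

  ½+½≈1 : ½ + ½ ≈ 1#
  ½+½≈1 = proj₂ halves

  0<½ : 0# < ½
  0<½ with <-cotrans 0<1 ½
  ... | inj₁ 0<½ = 0<½
  -- Here `½ < 1#` reads `0# + ½ < ½ + ½`, and `½` cancels.
  ... | inj₂ ½<1 =
    +-cancelʳ-< ½ (<-respˡ (sym (+-identityˡ ½)) (<-respʳ (sym ½+½≈1) ½<1))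

  -½+1≈½ : - ½ + 1# ≈ ½
  -½+1≈½ = begin
    - ½ + 1#       ≈⟨ +-congˡ ½+½≈1 ⟨
    - ½ + (½ + ½)  ≈⟨ +-assoc (- ½) ½ ½ ⟨
    - ½ + ½ + ½    ≈⟨ +-congʳ (-‿inverseˡ ½) ⟩
    0# + ½         ≈⟨ +-identityˡ ½ ⟩
    ½              ∎

  sum-mono-≤ : ∀ {n} {f g : Fin n → Carrier} → (∀ i → f i ≤ g i) → sum f ≤ sum g
  sum-mono-≤ {zero}  f≤g = ≤-refl
  sum-mono-≤ {suc n} f≤g = +-mono-≤ (f≤g zero) (sum-mono-≤ (λ i → f≤g (suc i)))

  ≤-foldr-⊔ : ∀ {z x xs} → x ∈ xs → x ≤ foldr _⊔_ z xs
  ≤-foldr-⊔ (here ≡.refl) = proj₁ (⊔-supremum _ _)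
  ≤-foldr-⊔ (there x∈xs)  =
    ≤-trans (≤-foldr-⊔ x∈xs) (proj₁ (proj₂ (⊔-supremum _ _)))

module ATPProperties {c ℓ₁ ℓ₂} (R : OrderedField c ℓ₁ ℓ₂) where
  open OrderedField R hiding (zero)
  open ATP R
  open OrderedFieldProperties R
  open SemiringSum semiring
    using (sum; sum-cong-≋; ∑-distrib-+; *-distribˡ-sum; *-distribʳ-sum)
  open ≈-Reasoning setoid

  -- Expectations, point masses and the fair coin.

  module _ {a} {A : Set a} where

    𝔼-upperBound : ∀ (d : Dist A) f {u} → (∀ x → f x ≤ u) → 𝔼 d f ≤ u
    𝔼-upperBound d f {u} f≤u =
      ≤-trans (sum-mono-≤ (λ i → *-monoˡ-≤ (weight≥0 i) (f≤u (outcome i))))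
        (≤-reflexive (begin
          sum (λ i → weight i * u)  ≈⟨ *-distribʳ-sum u weight ⟨
          sum weight * u            ≈⟨ *-congʳ total ⟩
          1# * u                    ≈⟨ *-identityˡ u ⟩
          u                         ∎))
      where open Dist d

    -- Used to move the average over the coin inside the algorithm's own randomization.
    𝔼-linear : ∀ (d : Dist A) α β f g →
      α * 𝔼 d f + β * 𝔼 d g ≈ 𝔼 d (λ x → α * f x + β * g x)
    𝔼-linear d α β f g = begin
      α * 𝔼 d f + β * 𝔼 d g
        ≈⟨ +-cong (*-distribˡ-sum α (λ i → weight i * f (outcome i)))
                  (*-distribˡ-sum β (λ i → weight i * g (outcome i))) ⟩
      sum (λ i → α * (weight i * f (outcome i))) + sum (λ i → β * (weight i * g (outcome i)))
        ≈⟨ ∑-distrib-+ (λ i → α * (weight i * f (outcome i)))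
                       (λ i → β * (weight i * g (outcome i))) ⟨
      sum (λ i → α * (weight i * f (outcome i)) + β * (weight i * g (outcome i)))
        ≈⟨ sum-cong-≋ (λ i → +-cong (swap α (weight i) _) (swap β (weight i) _)) ⟩
      sum (λ i → weight i * (α * f (outcome i)) + weight i * (β * g (outcome i)))
        ≈⟨ sum-cong-≋ (λ i → distribˡ (weight i) _ _) ⟨
      𝔼 d (λ x → α * f x + β * g x) ∎
      where
      open Dist d
      swap : ∀ x y z → x * (y * z) ≈ y * (x * z)
      swap x y z = trans (sym (*-assoc x y z)) (trans (*-congʳ (*-comm x y)) (*-assoc y x z))

    point : A → Dist A
    point x = record
      { size     = 1
      ; weight   = λ _ → 1#
      ; outcome  = λ _ → x
      ; weight≥0 = λ _ → <⇒≤ 0<1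
      ; total    = +-identityʳ 1#
      }

    𝔼-point : ∀ x f → 𝔼 (point x) f ≈ f x
    𝔼-point x f = trans (+-identityʳ (1# * f x)) (*-identityˡ (f x))

    𝔼-indep-points : ∀ n x f → 𝔼-indep (replicate n (point x)) f ≈ f (replicate n x)
    𝔼-indep-points zero    x f = refl
    𝔼-indep-points (suc n) x f =
      trans (𝔼-point x (λ y → 𝔼-indep (replicate n (point x)) (λ ys → f (y ∷ ys))))
            (𝔼-indep-points n x (λ ys → f (x ∷ ys)))

    fairCoin : A → A → Dist A
    fairCoin x y = record
      { size     = 2
      ; weight   = λ _ → ½
      ; outcome  = λ { zero → x ; (suc _) → y }
      ; weight≥0 = λ _ → <⇒≤ 0<½
      ; total    = trans (+-congˡ (+-identityʳ ½)) ½+½≈1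
      }

    𝔼-fairCoin : ∀ x y f → 𝔼 (fairCoin x y) f ≈ ½ * f x + ½ * f y
    𝔼-fairCoin x y f = +-congˡ (+-identityʳ (½ * f y))

  -- Lower bounds for the offline optimum on fixed prices.

  profit≤maxProfit : ∀ {T B n} (ps : Vec PriceTuple T) xs →
    Feasible B n ps xs → profit ps xs ≤ maxProfit B n ps
  profit≤maxProfit ps xs ok =
    ≤-foldr-⊔ (∈-map⁺ (profit ps) (∈-filter⁺ (feasible? _ _ ps) (∈-sequences xs) ok))

  skips-feasible : ∀ {T} B n (ps : Vec PriceTuple T) → Feasible B n ps (replicate T skip)
  skips-feasible B n []       = tt
  skips-feasible B n (p ∷ ps) = tt , skips-feasible B n ps

  profit-skips : ∀ {T} (ps : Vec PriceTuple T) → profit ps (replicate T skip) ≈ 0#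
  profit-skips []       = refl
  profit-skips (p ∷ ps) = trans (+-identityˡ _) (profit-skips ps)

  0≤maxProfit : ∀ {T} B n (ps : Vec PriceTuple T) → 0# ≤ maxProfit B n ps
  0≤maxProfit {T} B n ps =
    ≤-trans (≤-reflexive (sym (profit-skips ps)))
            (profit≤maxProfit ps (replicate T skip) (skips-feasible B n ps))

  -- The instance and its offline profit.

  cheap dull high : PriceTuple
  cheap = prices [ ½ ] 0# [ <⇒≤ 0<½ ] ≤-refl
  dull  = prices ⊤⁺ 0# (_ ≤⊤⁺) ≤-refl
  high  = prices ⊤⁺ 1# (_ ≤⊤⁺) (<⇒≤ 0<1)

  module _ (B : ℕ) (1≤B : 1 ≤ℕ B) where

    fairBet : Instance B 0
    fairBet = record
      -- Two rounds carry the bet; the `B` dull rounds make the horizon long enough for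
      -- `B ≤ B₀ + T`.
      { T      = 2 ℕ.+ B
      ; 𝒟      = point cheap ∷ fairCoin dull high ∷ replicate B (point dull)
      ; 1≤B    = 1≤B
      ; B₀≤B   = z≤n
      ; B₀≤T   = z≤n
      ; B≤B₀+T = ℕ.m≤n+m B 2
      }

    dulls : Vec PriceTuple B
    dulls = replicate B dull

    -- Only the coin is random, so two realizations remain. As `f` is arbitrary, the formula serves
    -- both the offline and the online profit.
    𝔼-fairBet : ∀ f → 𝔼-indep (Instance.𝒟 fairBet) f ≈
      ½ * f (cheap ∷ dull ∷ dulls) + ½ * f (cheap ∷ high ∷ dulls)
    𝔼-fairBet f = begin
      𝔼-indep (Instance.𝒟 fairBet) f
        ≈⟨ 𝔼-point cheap (λ p → 𝔼 (fairCoin dull high) (λ q → rest p q)) ⟩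
      𝔼 (fairCoin dull high) (rest cheap)
        ≈⟨ 𝔼-fairCoin dull high (rest cheap) ⟩
      ½ * rest cheap dull + ½ * rest cheap high
        ≈⟨ +-cong (*-congˡ (𝔼-indep-points B dull _)) (*-congˡ (𝔼-indep-points B dull _)) ⟩
      ½ * f (cheap ∷ dull ∷ dulls) + ½ * f (cheap ∷ high ∷ dulls) ∎
      where
      rest : PriceTuple → PriceTuple → Carrier
      rest p q = 𝔼-indep (replicate B (point dull)) (λ ps → f (p ∷ q ∷ ps))

    0<offlineProfit : 0# < offlineProfit fairBet
    0<offlineProfit = <-respʳ (sym (𝔼-fairBet (maxProfit B 0)))
      (+-nonNegative-positive
        (*-nonNegative (<⇒≤ 0<½) (0≤maxProfit B 0 (cheap ∷ dull ∷ dulls)))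
        (*-pos 0<½ (<-≤-trans (<-respʳ (sym gain≈½) 0<½)
          (profit≤maxProfit (cheap ∷ high ∷ dulls) (buy ∷ sell ∷ replicate B skip)
            -- Buying from an empty inventory requires `0 < B`, which unfolds to `1≤B`; after the
            -- sale the inventory is empty again.
            ((1≤B , tt) , s≤s z≤n , skips-feasible B 0 dulls)))))
      where
      gain≈½ : - ½ + (1# + profit dulls (replicate B skip)) ≈ ½
      gain≈½ = begin
        - ½ + (1# + profit dulls (replicate B skip))
          ≈⟨ +-congˡ (trans (+-congˡ (profit-skips dulls)) (+-identityʳ 1#)) ⟩
        - ½ + 1#  ≈⟨ -½+1≈½ ⟩
        ½         ∎

    -- Upper bounds for an arbitrary online algorithm.

    module _ (alg : OnlineAlgorithm fairBet) where

      run : ∀ {k} → History → Vec PriceTuple k → Carrier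
      run = runOn fairBet alg

      -- Randomizing cannot beat the best action, so a bound may be checked one allowed action at a
      -- time.
      run-upperBound : ∀ {k u} h p (ps : Vec PriceTuple k) →
        (((x , _) : ∃ (Allowed B (held 0 h) p)) → gain p x + run ((p , x) ∷ h) ps ≤ u) →
        run h (p ∷ ps) ≤ u
      run-upperBound h p ps =
        𝔼-upperBound (alg h p) (λ (x , _) → gain p x + run ((p , x) ∷ h) ps)

      run-dull≤0 : ∀ n h → run h (replicate n dull) ≤ 0#
      run-dull≤0 zero    h = ≤-refl
      run-dull≤0 (suc n) h = run-upperBound h dull (replicate n dull) λ where
        (buy  , _ , ())
        (sell , _) → +-nonPositive ≤-refl (run-dull≤0 n _)
        (skip , _) → +-nonPositive ≤-refl (run-dull≤0 n _)

      -- However many copies are held, a round permits a single sale, and the dull rounds that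
      -- follow earn nothing.
      run-high≤1 : ∀ n h → run h (high ∷ replicate n dull) ≤ 1#
      run-high≤1 n h = run-upperBound h high (replicate n dull) λ where
        (buy  , _ , ())
        (sell , _) → ≤-trans (+-mono-≤ ≤-refl (run-dull≤0 n _)) (≤-reflexive (+-identityʳ 1#))
        (skip , _) → ≤-trans (+-nonPositive ≤-refl (run-dull≤0 n _)) (<⇒≤ 0<1)

      run-high-empty≤0 : ∀ n h → held 0 h ≡ 0 → run h (high ∷ replicate n dull) ≤ 0#
      run-high-empty≤0 n h empty = run-upperBound h high (replicate n dull) λ where
        (buy  , _ , ())
        (sell , 0<held) → ⊥-elim (ℕ.<-irrefl (≡.sym empty) 0<held)
        (skip , _)      → +-nonPositive ≤-refl (run-dull≤0 n _)

      -- The first action precedes the coin, so both outcomes share the distribution `alg [] cheap`.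
      -- The profit is thus one expectation over first actions, and `bet≤0` bounds each of them.
      onlineProfit≤0 : onlineProfit fairBet alg ≤ 0#
      onlineProfit≤0 =
        ≤-trans (≤-reflexive (trans (𝔼-fairBet (run []))
                                    (𝔼-linear (alg [] cheap) ½ ½ (total dull) (total high))))
                (𝔼-upperBound (alg [] cheap) _ bet≤0)
        where
        total : PriceTuple → ∃ (Allowed B 0 cheap) → Carrier
        total q (x , _) = gain cheap x + run ((cheap , x) ∷ []) (q ∷ dulls)

        average≤0 : ∀ {x y} → x + y ≤ 0# → ½ * x + ½ * y ≤ 0#
        average≤0 {x} {y} x+y≤0 =
          ≤-trans (≤-reflexive (sym (distribˡ ½ x y)))
            (≤-trans (*-monoˡ-≤ (<⇒≤ 0<½) x+y≤0) (≤-reflexive (zeroʳ ½)))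

        bet≤0 : ∀ x → ½ * total dull x + ½ * total high x ≤ 0#
        -- Both outcomes bear the cost `½` and only `high` returns anything, at most `1#`. The low
        -- outcome is itself `dull`, which gives `suc B` dull rounds.
        bet≤0 (buy , _) = average≤0
          (≤-trans (+-mono-≤ (+-mono-≤ ≤-refl (run-dull≤0 (suc B) _))
                             (+-mono-≤ ≤-refl (run-high≤1 B _)))
            (≤-reflexive (begin
              - ½ + 0# + (- ½ + 1#)  ≈⟨ +-cong (+-identityʳ (- ½)) -½+1≈½ ⟩
              - ½ + ½                ≈⟨ -‿inverseˡ ½ ⟩
              0#                     ∎)))
        -- The case `sell` is absent, since it would need `0 < 0`. After a skip the inventory is
        -- still empty, so even `high` yields nothing.
        bet≤0 (skip , _) = average≤0
          (+-nonPositive (+-nonPositive ≤-refl (run-dull≤0 (suc B) _))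
                         (+-nonPositive ≤-refl (run-high-empty≤0 B _ ≡.refl)))

theorem1p1 : ∀ {c ℓ₁ ℓ₂} (R : OrderedField c ℓ₁ ℓ₂) →
  let open OrderedField R
      open ATP R
  in (B : ℕ) → 1 ≤ℕ B →
     Σ[ I ∈ Instance B 0 ]
       (0# < offlineProfit I) ×
       ((alg : OnlineAlgorithm I) → ¬ (0# < onlineProfit I alg))
theorem1p1 R B 1≤B =
  -- The last component fits because `x ≤ 0#` unfolds to the negation of `0# < x`.
  fairBet B 1≤B , 0<offlineProfit B 1≤B , onlineProfit≤0 B 1≤B
  where open ATPProperties R
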